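{- Let $\#\in\{\wedge,\vee,\to\}$ and let $\varphi\in\mathrm{For}(\Sigma)$. If $\nvdash_{\mathrm{RmbC}(\mathrm{ca}_\#)}\varphi$, then there exist a finite BALFI $\mathbf{A}\in\mathsf{BI}(\mathrm{ca}_\#)$ and a valuation $v:\mathrm{For}(\Sigma)\to A$ such that $v(\varphi)\neq 1$.
   Context: $\mathrm{For}(\Sigma)$ is the set of formulas built from a countably infinite set of propositional variables using binary $\wedge,\vee,\to$ and unary $\neg,\circ$; $\alpha\leftrightarrow\beta$ abbreviates $(\alpha\to\beta)\wedge(\beta\to\alpha)$. The logic $\mathrm{RmbC}$ is given by the Hilbert calculus with axiom schemas $\alpha\to(\beta\to\alpha)$; $(\alpha\to(\beta\to\gamma))\to((\alpha\to\beta)\to(\alpha\to\gamma))$; $\alpha\to(\beta\to(\alpha\wedge\beta))$; $(\alpha\wedge\beta)\to\alpha$; $(\alpha\wedge\beta)\to\beta$; $\alpha\to(\alpha\vee\beta)$; $\beta\to(\alpha\vee\beta)$; $(\alpha\to\gamma)\to((\beta\to\gamma)\to((\alpha\vee\beta)\to\gamma))$; $(\alpha\to\beta)\vee\alpha$; $\alpha\vee\neg\alpha$; $\circ\alpha\to(\alpha\to(\neg\alpha\to\beta))$; and inference rules: modus ponens; $(R_\neg)$: from $\alpha\leftrightarrow\psi$ infer $\neg\alpha\leftrightarrow\neg\psi$; $(R_\circ)$: from $\alpha\leftrightarrow\psi$ infer $\circ\alpha\leftrightarrow\circ\psi$. $\mathrm{RmbC}(\mathrm{ca}_\#)$ is obtained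 by adding the axiom schema $(\mathrm{ca}_\#)$: $(\circ\alpha\wedge\circ\beta)\to\circ(\alpha\#\beta)$, and $\vdash_{\mathrm{RmbC}(\mathrm{ca}_\#)}\varphi$ means $\varphi$ is derivable in it (without premises). A BALFI is an algebra $\mathbf{B}=\langle B,\wedge,\vee,\to,\neg,\circ,0,1\rangle$ such that $\langle B,\wedge,\vee,\to,0,1\rangle$ is a Boolean algebra and, for every $a\in B$, $a\vee\neg a=1$ and $a\wedge\neg a\wedge\circ a=0$. A valuation over $\mathbf{B}$ is a homomorphism $v:\mathrm{For}(\Sigma)\to B$. $\mathsf{BI}(\mathrm{ca}_\#)$ is the class of BALFIs validating $(\mathrm{ca}_\#)$, equivalently satisfying $(\circ a\wedge\circ b)\wedge\circ(a\# b)=\circ a\wedge\circ b$ for all $a,b$. -}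

module Defs where

open import Algebra.Core using (Op₁; Op₂)
open import Algebra.Definitions using (Congruent₁)
open import Algebra.Lattice.Structures using (IsBooleanAlgebra)
open import Data.Fin.Base using (Fin)
open import Data.Nat.Base using (ℕ)
open import Data.Product.Base using (∃-syntax)
open import Function.Bundles using (Inverse)
open import Level using (Level; 0ℓ; suc; _⊔_)
open import Relation.Binary.Bundles using (Setoid)
open import Relation.Binary.Core using (Rel)
open import Relation.Binary.PropositionalEquality.Properties using (setoid)
open import Relation.Unary using (Pred; _∪_)

private
  variable
    a ℓ : Level

infix  9 `¬_ `∘_
infixr 7 _`∧_
infixr 6 _`∨_
infixr 5 _`→_
infix  4 _`↔_

data Formula : Set where
  var             : ℕ → Formula
  _`∧_ _`∨_ _`→_ : Formula → Formula → Formula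
  `¬_ `∘_         : Formula → Formula

_`↔_ : Formula → Formula → Formula
α `↔ β = (α `→ β) `∧ (β `→ α)

data Connective : Set where
  and or imp : Connective

_⟨_⟩_ : Formula → Connective → Formula → Formula
α ⟨ and ⟩ β = α `∧ β
α ⟨ or  ⟩ β = α `∨ β
α ⟨ imp ⟩ β = α `→ β

data RmbC : Pred Formula 0ℓ where
  ax-k     : ∀ α β   → RmbC (α `→ (β `→ α))
  ax-s     : ∀ α β γ → RmbC ((α `→ (β `→ γ)) `→ ((α `→ β) `→ (α `→ γ)))
  ax-pair  : ∀ α β   → RmbC (α `→ (β `→ (α `∧ β)))
  ax-fst   : ∀ α β   → RmbC ((α `∧ β) `→ α)
  ax-snd   : ∀ α β   → RmbC ((α `∧ β) `→ β)
  ax-inl   : ∀ α β   → RmbC (α `→ (α `∨ β))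
  ax-inr   : ∀ α β   → RmbC (β `→ (α `∨ β))
  ax-case  : ∀ α β γ → RmbC ((α `→ γ) `→ ((β `→ γ) `→ ((α `∨ β) `→ γ)))
  ax-class : ∀ α β   → RmbC ((α `→ β) `∨ α)
  ax-em    : ∀ α     → RmbC (α `∨ (`¬ α))
  ax-bc    : ∀ α β   → RmbC ((`∘ α) `→ (α `→ ((`¬ α) `→ β)))

data Ca (# : Connective) : Pred Formula 0ℓ where
  ca : ∀ α β → Ca # (((`∘ α) `∧ (`∘ β)) `→ (`∘ (α ⟨ # ⟩ β)))

-- Derivability without premises, so the replacement rules R¬ and R∘ apply to
-- theorems only.
infix 3 _⊢_
data _⊢_ (Ax : Pred Formula 0ℓ) : Pred Formula 0ℓ where
  axiom : ∀ {α} → Ax α → Ax ⊢ α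
  mp    : ∀ {α β} → Ax ⊢ α → Ax ⊢ α `→ β → Ax ⊢ β
  R¬    : ∀ {α β} → Ax ⊢ α `↔ β → Ax ⊢ (`¬ α) `↔ (`¬ β)
  R∘    : ∀ {α β} → Ax ⊢ α `↔ β → Ax ⊢ (`∘ α) `↔ (`∘ β)

RmbC[ca_] : Connective → Pred Formula 0ℓ
RmbC[ca # ] = RmbC ∪ Ca #

-- The signature has → and 0 but no Boolean complement: the complement of x is
-- x ⇒ 0#.  The operation ¬ is the paraconsistent negation, in general different
-- from that complement.
record BALFI a ℓ : Set (suc (a ⊔ ℓ)) where
  infix  9 ¬_ ∘_
  infixr 7 _∧_
  infixr 6 _∨_
  infixr 5 _⇒_
  infix  4 _≈_
  field
    Carrier          : Set a
    _≈_              : Rel Carrier ℓ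
    _∧_ _∨_ _⇒_      : Op₂ Carrier
    ¬_ ∘_            : Op₁ Carrier
    0# 1#            : Carrier
    isBooleanAlgebra : IsBooleanAlgebra _≈_ _∨_ _∧_ (_⇒ 0#) 1# 0#
    ⇒-def            : ∀ x y → x ⇒ y ≈ (x ⇒ 0#) ∨ y
    ¬-cong           : Congruent₁ _≈_ ¬_
    ∘-cong           : Congruent₁ _≈_ ∘_
    ∨-¬              : ∀ x → x ∨ (¬ x) ≈ 1#
    ∧-¬-∘            : ∀ x → (x ∧ (¬ x)) ∧ (∘ x) ≈ 0#

  open IsBooleanAlgebra isBooleanAlgebra public
    using (isEquivalence)

  carrierSetoid : Setoid a ℓ
  carrierSetoid = record { isEquivalence = isEquivalence }

record Valuation (B : BALFI a ℓ) : Set (a ⊔ ℓ) where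
  open BALFI B
  field
    ⟦_⟧    : Formula → Carrier
    ∧-homo : ∀ α β → ⟦ α `∧ β ⟧ ≈ ⟦ α ⟧ ∧ ⟦ β ⟧
    ∨-homo : ∀ α β → ⟦ α `∨ β ⟧ ≈ ⟦ α ⟧ ∨ ⟦ β ⟧
    →-homo : ∀ α β → ⟦ α `→ β ⟧ ≈ ⟦ α ⟧ ⇒ ⟦ β ⟧
    ¬-homo : ∀ α → ⟦ `¬ α ⟧ ≈ ¬ ⟦ α ⟧
    ∘-homo : ∀ α → ⟦ `∘ α ⟧ ≈ ∘ ⟦ α ⟧

_satisfies_ : {B : BALFI a ℓ} → Valuation B → Formula → Set ℓ
_satisfies_ {B = B} v α = Valuation.⟦_⟧ v α ≈ 1#
  where open BALFI B

BI[ca_] : Connective → Pred (BALFI a ℓ) (a ⊔ ℓ)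
BI[ca # ] B = ∀ (v : Valuation B) {α} → Ca # α → v satisfies α

Finite : Pred (BALFI a ℓ) (a ⊔ ℓ)
Finite B = ∃[ n ] Inverse (BALFI.carrierSetoid B) (setoid (Fin n))

{-# OPTIONS --safe #-}
-- Filtration: worlds are bit assignments to the subformulas of φ, elements of
-- the model are sets of worlds.  In the model ∘b holds at w iff b lies in the
-- #-closure of the sets ⟦ψ⟧ with ∘ψ true at w, which forces ca_#; and ¬b is the
-- complement of b enlarged by the sets ⟦¬ψ⟧ with b = ⟦ψ⟧.  Over the set of all
-- consistent worlds, formulas with equal truth sets are provably equivalent, so
-- R¬ and R∘ give the truth lemma and the BALFI laws.
--
-- Consistency of a world is not decidable a priori, so constructively the
-- consistent worlds are approached from above: starting from all worlds, either
-- the model is as wanted or it exhibits a world that is (doubly negated)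
-- inconsistent and can be removed.  The invariant is that a formula derivable
-- from each remaining world is not unprovable; hence φ fails in the final model.
module Submission where

open import Defs
open import Algebra.Lattice.Structures using (IsBooleanAlgebra)
open import Data.Bool.Base as Bool using (Bool; true; false; not)
import Data.Bool.Properties as Bool
open import Data.Fin.Base as Fin using (Fin; punchIn; punchOut)
open import Data.Fin.Properties as Fin using (2↔Bool; *↔×; any?; all?; punchIn-punchOut; sequence)
open import Data.Fin.Subset using (Subset; _∈_; _∩_; _∪_; ∁; ⊤; ⊥)
open import Data.Fin.Subset.Properties using
  ( _∈?_; anySubset?; Empty-unique; ∪-∩-isBooleanAlgebra; ∪-identityʳ; ∪-inverse; ∩-inverse
  ; x∈p∩q⁻ )
open import Data.List.Base as List using (List; []; _∷_; _++_)
open import Data.List.Membership.Propositional using (find; lose) renaming (_∈_ to _∈ₗ_)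
open import Data.List.Membership.Propositional.Properties using (∈-++⁺ˡ; ∈-++⁺ʳ; ∈-++⁻; ∈-map⁺)
open import Data.List.Relation.Binary.Subset.Propositional using (_⊆_)
open import Data.List.Relation.Unary.All using (All; []; _∷_)
open import Data.List.Relation.Unary.Any as Any using (Any; here; there; index)
open import Data.List.Relation.Unary.Any.Properties using (lookup-index)
open import Data.Maybe.Base using (just; nothing; zipWith; map)
open import Data.Nat.Base using (ℕ; zero; suc; _^_)
import Data.Nat.Properties as ℕ
open import Data.Product.Base using (_×_; _,_; proj₁; proj₂; Σ-syntax; ∃-syntax; uncurry)
open import Data.Product.Function.NonDependent.Propositional using (_×-↔_)
open import Data.Sum.Base using (_⊎_; inj₁; inj₂; [_,_]′)
open import Data.Vec.Base using ([]; _∷_; lookup; tabulate)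
open import Data.Vec.Properties using
  ( ≡-dec; lookup∘tabulate; tabulate∘lookup; tabulate-cong; lookup-zipWith; lookup-map
  ; lookup-replicate; []=⇒lookup; lookup⇒[]= )
open import Effect.Monad using (RawMonad)
open import Function.Base using (_∘_; _$_; id)
open import Function.Bundles using (_↔_; mk↔ₛ′; Inverse)
open import Function.Properties.Inverse using (↔-sym; ↔-trans)
open import Level using (0ℓ)
open import Relation.Binary.Definitions using (WeaklyDecidable; DecidableEquality)
open import Relation.Binary.PropositionalEquality
open import Relation.Nullary using (¬_; Dec; yes; no; does; contradiction)
open import Relation.Nullary.Decidable using
  ( _×-dec_; _→-dec_; _⊎-dec_; ¬?; map′; decidable-stable; dec-true; dec-false
  ; ¬¬-excluded-middle )
open import Relation.Nullary.Negation using (¬¬-Monad)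
open import Relation.Unary using (Pred; Decidable)

private
  variable
    n : ℕ
    α β γ : Formula
    Γ : List Formula

-- Finite sets

lookup-ext : {p q : Subset n} → (∀ i → lookup p i ≡ lookup q i) → p ≡ q
lookup-ext {p = p} {q} eq = begin
  p                    ≡⟨ tabulate∘lookup p ⟨
  tabulate (lookup p)  ≡⟨ tabulate-cong eq ⟩
  tabulate (lookup q)  ≡⟨ tabulate∘lookup q ⟩
  q                    ∎
  where open ≡-Reasoning

_≟ˢ_ : DecidableEquality (Subset n)
_≟ˢ_ = ≡-dec Bool._≟_

module _ {P : Pred (Fin n) 0ℓ} (P? : Decidable P) where

  comprehension : Subset n
  comprehension = tabulate (does ∘ P?)

  ∈-comprehension⁺ : ∀ {i} → P i → i ∈ comprehension
  ∈-comprehension⁺ {i} p =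
    lookup⇒[]= i _ (trans (lookup∘tabulate (does ∘ P?) i) (dec-true (P? i) p))

  ∈-comprehension⁻ : ∀ {i} → i ∈ comprehension → P i
  ∈-comprehension⁻ {i} i∈ = decidable-stable (P? i) λ ¬p → contradiction
    (trans (sym ([]=⇒lookup i∈)) (trans (lookup∘tabulate (does ∘ P?) i) (dec-false (P? i) ¬p)))
    λ ()

∷-↔ : (Bool × Subset n) ↔ Subset (suc n)
∷-↔ = mk↔ₛ′ (uncurry _∷_) (λ { (b ∷ p) → b , p }) (λ { (_ ∷ _) → refl }) (λ _ → refl)

Subset↔Fin : ∀ n → Subset n ↔ Fin (2 ^ n)
Subset↔Fin zero    = mk↔ₛ′ (λ _ → Fin.zero) (λ _ → [])
  (λ { Fin.zero → refl ; (Fin.suc ()) }) (λ { [] → refl })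
Subset↔Fin (suc n) = ↔-trans (↔-sym ∷-↔)
  (↔-trans (↔-sym 2↔Bool ×-↔ Subset↔Fin n) (↔-sym *↔×))

-- Closure of a decidable subset of a finite set under a binary operation.
-- Quantifying over all closed subsets makes membership decidable; the price
-- is an induction principle with doubly negated conclusion.
module Closure {X : Set} {m : ℕ} (X↔Fin : X ↔ Fin m) (_∙_ : X → X → X) where

  open Inverse X↔Fin using (to; from; strictlyInverseʳ)

  private
    infix 4 _∈′_ _∈′?_
    _∈′_ : X → Subset m → Set
    x ∈′ C = to x ∈ C

    _∈′?_ : ∀ x C → Dec (x ∈′ C)
    x ∈′? C = to x ∈? C

  Closed : Subset m → Set
  Closed C = ∀ i j → i ∈ C → j ∈ C → (from i ∙ from j) ∈′ C

  Contains : Pred X 0ℓ → Subset m → Set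
  Contains S C = ∀ i → S (from i) → i ∈ C

  Generated : Pred X 0ℓ → Pred X 0ℓ
  Generated S x = ∀ C → Contains S C → Closed C → x ∈′ C

  module _ (S : Pred X 0ℓ) where

    generated? : Decidable S → Decidable (Generated S)
    generated? S? x = map′
      (λ ∄C C S⊆C closed → decidable-stable (x ∈′? C) λ x∉C → ∄C (C , S⊆C , closed , x∉C))
      (λ gen (C , S⊆C , closed , x∉C) → x∉C (gen C S⊆C closed))
      (¬? (anySubset? λ C →
        all? (λ i → S? (from i) →-dec (i ∈? C)) ×-dec
        all? (λ i → all? λ j → (i ∈? C) →-dec ((j ∈? C) →-dec ((from i ∙ from j) ∈′? C))) ×-dec
        ¬? (x ∈′? C)))

    generator : ∀ {x} → S x → Generated S x
    generator {x} s C S⊆C _ = S⊆C (to x) (subst S (sym (strictlyInverseʳ x)) s)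

    generated-∙ : ∀ {x y} → Generated S x → Generated S y → Generated S (x ∙ y)
    generated-∙ {x} {y} gx gy C S⊆C closed = subst (_∈′ C)
      (cong₂ _∙_ (strictlyInverseʳ x) (strictlyInverseʳ y))
      (closed _ _ (gx C S⊆C closed) (gy C S⊆C closed))

    -- `P` need not be decidable. Since the index set is finite, excluded middle for all its
    -- elements holds under a single double negation; `P` then cuts out a closed subset to which
    -- `gen` applies.
    generated-induction : (P : Pred X 0ℓ) →
      (∀ {x} → S x → P x) → (∀ {x y} → P x → P y → P (x ∙ y)) →
      ∀ {x} → Generated S x → ¬ ¬ P x
    generated-induction P base step {x} gen ¬Px =
      sequence (RawMonad.rawApplicative ¬¬-Monad) {P = Dec ∘ P ∘ from}
        (λ _ → ¬¬-excluded-middle) λ P? →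
        let
          closed : Closed (comprehension P?)
          closed i j i∈ j∈ = ∈-comprehension⁺ P? $ subst P (sym (strictlyInverseʳ _)) $
            step (∈-comprehension⁻ P? i∈) (∈-comprehension⁻ P? j∈)
        in ¬Px $ subst P (strictlyInverseʳ x) $ ∈-comprehension⁻ P? $
           gen (comprehension P?) (λ _ → ∈-comprehension⁺ P? ∘ base) closed

-- Formulas and worlds

infix 4 _≟ᶠ_
-- A semi-decision avoids refuting each pair of distinct constructors; `≟ᶠ-refl` supplies the
-- completeness on the diagonal.
_≟ᶠ_ : WeaklyDecidable {A = Formula} _≡_
var m    ≟ᶠ var n      with m ℕ.≟ n
... | yes refl = just refl
... | no  _    = nothing
(α `∧ β) ≟ᶠ (α′ `∧ β′) = zipWith (cong₂ _`∧_) (α ≟ᶠ α′) (β ≟ᶠ β′)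
(α `∨ β) ≟ᶠ (α′ `∨ β′) = zipWith (cong₂ _`∨_) (α ≟ᶠ α′) (β ≟ᶠ β′)
(α `→ β) ≟ᶠ (α′ `→ β′) = zipWith (cong₂ _`→_) (α ≟ᶠ α′) (β ≟ᶠ β′)
(`¬ α)   ≟ᶠ (`¬ α′)    = map (cong `¬_) (α ≟ᶠ α′)
(`∘ α)   ≟ᶠ (`∘ α′)    = map (cong `∘_) (α ≟ᶠ α′)
_        ≟ᶠ _          = nothing

≟ᶠ-refl : ∀ α → (α ≟ᶠ α) ≡ just refl
≟ᶠ-refl (var m) with m ℕ.≟ m
... | yes refl = refl
... | no  m≢m  = contradiction refl m≢m
≟ᶠ-refl (α `∧ β) rewrite ≟ᶠ-refl α | ≟ᶠ-refl β = refl
≟ᶠ-refl (α `∨ β) rewrite ≟ᶠ-refl α | ≟ᶠ-refl β = refl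
≟ᶠ-refl (α `→ β) rewrite ≟ᶠ-refl α | ≟ᶠ-refl β = refl
≟ᶠ-refl (`¬ α)   rewrite ≟ᶠ-refl α = refl
≟ᶠ-refl (`∘ α)   rewrite ≟ᶠ-refl α = refl

sub : Formula → List Formula
sub (var m)  = var m ∷ []
sub (α `∧ β) = (α `∧ β) ∷ sub α ++ sub β
sub (α `∨ β) = (α `∨ β) ∷ sub α ++ sub β
sub (α `→ β) = (α `→ β) ∷ sub α ++ sub β
sub (`¬ α)   = (`¬ α) ∷ sub α
sub (`∘ α)   = (`∘ α) ∷ sub α

sub-refl : ∀ α → α ∈ₗ sub α
sub-refl (var _)  = here refl
sub-refl (_ `∧ _) = here refl
sub-refl (_ `∨ _) = here refl
sub-refl (_ `→ _) = here refl
sub-refl (`¬ _)   = here refl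
sub-refl (`∘ _)   = here refl

module _ where
  private
    ++-trans : ∀ α β → (γ ∈ₗ sub α → sub γ ⊆ sub α) → (γ ∈ₗ sub β → sub γ ⊆ sub β) →
      γ ∈ₗ sub α ++ sub β → sub γ ⊆ sub α ++ sub β
    ++-trans α β transα transβ γ∈ δ∈ = [ (λ γ∈α → ∈-++⁺ˡ (transα γ∈α δ∈))
                                       , (λ γ∈β → ∈-++⁺ʳ (sub α) (transβ γ∈β δ∈)) ]′
                                       (∈-++⁻ (sub α) γ∈)

  sub-trans : ∀ α → γ ∈ₗ sub α → sub γ ⊆ sub α
  sub-trans (var _)  (here refl) = id
  sub-trans (_ `∧ _) (here refl) = id
  sub-trans (α `∧ β) (there γ∈)  = there ∘ ++-trans α β (sub-trans α) (sub-trans β) γ∈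
  sub-trans (_ `∨ _) (here refl) = id
  sub-trans (α `∨ β) (there γ∈)  = there ∘ ++-trans α β (sub-trans α) (sub-trans β) γ∈
  sub-trans (_ `→ _) (here refl) = id
  sub-trans (α `→ β) (there γ∈)  = there ∘ ++-trans α β (sub-trans α) (sub-trans β) γ∈
  sub-trans (`¬ _)   (here refl) = id
  sub-trans (`¬ α)   (there γ∈)  = there ∘ sub-trans α γ∈
  sub-trans (`∘ _)   (here refl) = id
  sub-trans (`∘ α)   (there γ∈)  = there ∘ sub-trans α γ∈

-- A world also assigns bits to compound subformulas, which `eval` ignores.
World : List Formula → Set
World = All (λ _ → Bool)

worlds : ∀ Γ → List (World Γ)
worlds []      = [] ∷ []
worlds (_ ∷ Γ) = List.map (true ∷_) (worlds Γ) ++ List.map (false ∷_) (worlds Γ)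

-- Formulas outside Γ get the value false.
infix 8 _!_
_!_ : World Γ → Formula → Bool
_!_ {[]}    []      β = false
_!_ {α ∷ _} (b ∷ w) β with α ≟ᶠ β
... | just _  = b
... | nothing = w ! β

_⟨_⟩ᵇ_ : Bool → Connective → Bool → Bool
a ⟨ and ⟩ᵇ b = a Bool.∧ b
a ⟨ or  ⟩ᵇ b = a Bool.∨ b
a ⟨ imp ⟩ᵇ b = not a Bool.∨ b

_⟨_⟩ˢ_ : Subset n → Connective → Subset n → Subset n
p ⟨ and ⟩ˢ q = p ∩ q
p ⟨ or  ⟩ˢ q = p ∪ q
p ⟨ imp ⟩ˢ q = ∁ p ∪ q

lookup-⟨⟩ : ∀ c (p q : Subset n) i → lookup (p ⟨ c ⟩ˢ q) i ≡ lookup p i ⟨ c ⟩ᵇ lookup q i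
lookup-⟨⟩ and p q i = lookup-zipWith Bool._∧_ i p q
lookup-⟨⟩ or  p q i = lookup-zipWith Bool._∨_ i p q
lookup-⟨⟩ imp p q i = trans (lookup-zipWith Bool._∨_ i (∁ p) q)
                            (cong (Bool._∨ lookup q i) (lookup-map i not p))

∁-∪-⊤ : {p q : Subset n} → (∀ i → i ∈ p → i ∈ q) → ∁ p ∪ q ≡ ⊤
∁-∪-⊤ {p = p} {q} p⊆q = lookup-ext λ i → trans (lookup-⟨⟩ imp p q i)
  (trans (holds i) (sym (lookup-replicate i true)))
  where
  holds : ∀ i → not (lookup p i) Bool.∨ lookup q i ≡ true
  holds i with lookup p i in eq
  ... | true  = []=⇒lookup (p⊆q i (lookup⇒[]= i p eq))
  ... | false = refl

eval : World Γ → Formula → Bool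
eval w (var m)  = w ! var m
eval w (α `∧ β) = eval w α ⟨ and ⟩ᵇ eval w β
eval w (α `∨ β) = eval w α ⟨ or ⟩ᵇ eval w β
eval w (α `→ β) = eval w α ⟨ imp ⟩ᵇ eval w β
eval w (`¬ α)   = w ! (`¬ α)
eval w (`∘ α)   = w ! (`∘ α)

-- The signature has no bottom. By `ax-bc` this conjunction implies every formula, so implying
-- `falsum` acts as classical negation, which the paraconsistent ¬ does not.
falsum : Formula
falsum = var 0 `∧ ((`¬ (var 0)) `∧ (`∘ (var 0)))

signed : Bool → Formula → Formula
signed true  α = α
signed false α = α `→ falsum

literals : World Γ → List Formula
literals {[]}    []      = []
literals {α ∷ _} (b ∷ w) = signed b α ∷ literals w

-- Derivations from hypotheses

module Calculus (# : Connective) where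

  Thm : Formula → Set
  Thm α = RmbC[ca # ] ⊢ α

  infix 3 _⊩_
  infixl 5 _·_
  -- Only modus ponens acts on hypotheses; R¬ and R∘ enter through `thm` alone. This is what keeps
  -- the deduction theorem valid.
  data _⊩_ (Γ : List Formula) : Formula → Set where
    hyp : α ∈ₗ Γ → Γ ⊩ α
    thm : Thm α → Γ ⊩ α
    _·_ : Γ ⊩ α `→ β → Γ ⊩ α → Γ ⊩ β

  ax : RmbC α → Γ ⊩ α
  ax = thm ∘ axiom ∘ inj₁

  discharge : [] ⊩ α → Thm α
  discharge (thm t) = t
  discharge (s · t) = mp (discharge t) (discharge s)

  weaken : Γ ⊩ β → α ∷ Γ ⊩ β
  weaken (hyp β∈) = hyp (there β∈)
  weaken (thm t)  = thm t
  weaken (s · t)  = weaken s · weaken t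

  deduction : α ∷ Γ ⊩ β → Γ ⊩ α `→ β
  deduction {α = α} (hyp (here refl)) = ax (ax-s α (α `→ α) α) · ax (ax-k _ _) · ax (ax-k _ _)
  deduction (hyp (there β∈)) = ax (ax-k _ _) · hyp β∈
  deduction (thm t)          = ax (ax-k _ _) · thm t
  deduction (s · t)          = ax (ax-s _ _ _) · deduction s · deduction t

  assumption : α ∷ Γ ⊩ α
  assumption = hyp (here refl)

  pair : Γ ⊩ α → Γ ⊩ β → Γ ⊩ α `∧ β
  pair s t = ax (ax-pair _ _) · s · t

  fst : Γ ⊩ α `∧ β → Γ ⊩ α
  fst t = ax (ax-fst _ _) · t

  snd : Γ ⊩ α `∧ β → Γ ⊩ β
  snd t = ax (ax-snd _ _) · t

  cases : Γ ⊩ α `∨ β → Γ ⊩ α `→ γ → Γ ⊩ β `→ γ → Γ ⊩ γ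
  cases t l r = ax (ax-case _ _ _) · l · r · t

  explosion : Γ ⊩ α → Γ ⊩ `¬ α → Γ ⊩ `∘ α → Γ ⊩ β
  explosion a ¬a ∘a = ax (ax-bc _ _) · ∘a · a · ¬a

  exfalso : Γ ⊩ falsum → Γ ⊩ β
  exfalso t = explosion (fst t) (fst (snd t)) (snd (snd t))

  by-cases : α ∷ Γ ⊩ β → signed false α ∷ Γ ⊩ β → Γ ⊩ β
  -- With `falsum` as consequent, `ax-class` is excluded middle for the classical negation.
  by-cases l r = cases (ax (ax-class _ falsum)) (deduction r) (deduction l)

  signed-⟨⟩ : ∀ c a b → Γ ⊩ signed a α → Γ ⊩ signed b β → Γ ⊩ signed (a ⟨ c ⟩ᵇ b) (α ⟨ c ⟩ β)
  signed-⟨⟩ and true  true  s t = pair s t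
  signed-⟨⟩ and true  false s t = deduction (weaken t · snd assumption)
  signed-⟨⟩ and false _     s t = deduction (weaken s · fst assumption)
  signed-⟨⟩ or  true  _     s t = ax (ax-inl _ _) · s
  signed-⟨⟩ or  false true  s t = ax (ax-inr _ _) · t
  signed-⟨⟩ or  false false s t = deduction (cases assumption (weaken s) (weaken t))
  signed-⟨⟩ imp true  true  s t = deduction (weaken t)
  signed-⟨⟩ imp true  false s t = deduction (weaken t · (assumption · weaken s))
  signed-⟨⟩ imp false _     s t = deduction (exfalso (weaken s · assumption))

  signed-↔ : ∀ b → Γ ⊩ signed b α → Γ ⊩ signed b β → Γ ⊩ α `↔ β
  signed-↔ true  s t = pair (deduction (weaken t)) (deduction (weaken s))
  signed-↔ false s t = pair (deduction (exfalso (weaken s · assumption)))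
                            (deduction (exfalso (weaken t · assumption)))

  -- No membership hypothesis: formulas outside Γ read as false, so a true bit must come from a
  -- literal.
  lookup-true : (w : World Γ) → w ! β ≡ true → literals w ⊩ β
  lookup-true {α ∷ _} {β} (b ∷ w) eq with α ≟ᶠ β
  lookup-true (true ∷ w) refl | just refl = assumption
  lookup-true (b ∷ w)    eq   | nothing   = weaken (lookup-true w eq)

  signed-lookup : (w : World Γ) → β ∈ₗ Γ → literals w ⊩ signed (w ! β) β
  signed-lookup {β = β} (b ∷ w) (here refl) rewrite ≟ᶠ-refl β = assumption
  signed-lookup {α ∷ _} {β} (b ∷ w) (there β∈) with α ≟ᶠ β
  -- Γ may repeat formulas. `!` reads the first occurrence, whose literal is the head hypothesis.
  ... | just refl = assumption
  ... | nothing   = weaken (signed-lookup w β∈)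

  -- Kalmár's lemma, with ¬- and ∘-formulas read off the literals like atoms, since their values are
  -- not determined by those of their components.
  signed-eval : (w : World Γ) → ∀ α → sub α ⊆ Γ → literals w ⊩ signed (eval w α) α
  signed-eval w (var m)  α⊆ = signed-lookup w (α⊆ (here refl))
  signed-eval w (α `∧ β) α⊆ = signed-⟨⟩ and _ _
    (signed-eval w α (α⊆ ∘ there ∘ ∈-++⁺ˡ)) (signed-eval w β (α⊆ ∘ there ∘ ∈-++⁺ʳ (sub α)))
  signed-eval w (α `∨ β) α⊆ = signed-⟨⟩ or _ _
    (signed-eval w α (α⊆ ∘ there ∘ ∈-++⁺ˡ)) (signed-eval w β (α⊆ ∘ there ∘ ∈-++⁺ʳ (sub α)))
  signed-eval w (α `→ β) α⊆ = signed-⟨⟩ imp _ _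
    (signed-eval w α (α⊆ ∘ there ∘ ∈-++⁺ˡ)) (signed-eval w β (α⊆ ∘ there ∘ ∈-++⁺ʳ (sub α)))
  signed-eval w (`¬ α)   α⊆ = signed-lookup w (α⊆ (here refl))
  signed-eval w (`∘ α)   α⊆ = signed-lookup w (α⊆ (here refl))

  -- The literals are discharged one at a time by classical case distinction, both signs of each
  -- being present among the worlds.
  worlds-cover : ∀ Γ → (∀ {w} → w ∈ₗ worlds Γ → literals w ⊩ α) → [] ⊩ α
  worlds-cover []      all⊩ = all⊩ (here refl)
  worlds-cover (β ∷ Γ) all⊩ = worlds-cover Γ λ w∈ → by-cases
    (all⊩ (∈-++⁺ˡ (∈-map⁺ (true ∷_) w∈)))
    (all⊩ (∈-++⁺ʳ (List.map (true ∷_) (worlds Γ)) (∈-map⁺ (false ∷_) w∈)))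

  -- Coverings by worlds

  module _ (φ : Formula) where

    -- The double negation lets the property survive removals whose evidence is itself only doubly
    -- negated.
    Covering : (Fin n → World (sub φ)) → Set
    Covering W = ∀ {θ} → (∀ i → literals (W i) ⊩ θ) → ¬ ¬ Thm θ

    Inconsistent : World (sub φ) → Set
    Inconsistent w = ¬ ¬ (literals w ⊩ falsum)

    initial-covering : Covering (List.lookup (worlds (sub φ)))
    initial-covering {θ} all⊩ ¬⊢ = ¬⊢ $ discharge $ worlds-cover (sub φ) λ w∈ →
      subst (λ w → literals w ⊩ θ) (sym (lookup-index w∈)) (all⊩ (index w∈))

    -- An inconsistent world derives every θ, so it imposes no condition on θ.
    remove-inconsistent : (W : Fin (suc n) → World (sub φ)) → ∀ i →
      Inconsistent (W i) → Covering W → Covering (W ∘ punchIn i)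
    remove-inconsistent W i bad covering {θ} all⊩ ¬⊢ = bad λ ⊩falsum →
      covering (everywhere ⊩falsum) ¬⊢
      where
      everywhere : literals (W i) ⊩ falsum → ∀ j → literals (W j) ⊩ θ
      everywhere ⊩falsum j with i Fin.≟ j
      ... | yes refl = exfalso ⊩falsum
      ... | no  i≢j  = subst (λ j → literals (W j) ⊩ θ) (punchIn-punchOut i≢j)
                         (all⊩ (punchOut i≢j))

    -- The filtration model

    module Model {k : ℕ} (W : Fin k → World (sub φ)) where

      truth : Formula → Subset k
      truth α = tabulate λ i → eval (W i) α

      -- If `op ψ` is not a subformula of φ, its bit is the default false, so only subformulas of
      -- the form `op ψ` contribute.
      Asserts : (Formula → Formula) → Fin k → Pred (Subset k) 0ℓ
      Asserts op i b = Any (λ ψ → b ≡ truth ψ × W i ! op ψ ≡ true) (sub φ)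

      asserts? : ∀ op i → Decidable (Asserts op i)
      asserts? op i b = Any.any? (λ ψ → (b ≟ˢ truth ψ) ×-dec (W i ! op ψ Bool.≟ true)) (sub φ)

      open Closure (Subset↔Fin k) (_⟨ # ⟩ˢ_)

      consistent? : ∀ b → Decidable λ i → Generated (Asserts `∘_ i) b
      consistent? b i = generated? (Asserts `∘_ i) (asserts? `∘_ i) b

      consistency : Subset k → Subset k
      consistency b = comprehension (consistent? b)

      negates? : ∀ b → Decidable λ i → lookup b i ≡ false ⊎ Asserts `¬_ i b
      negates? b i = (lookup b i Bool.≟ false) ⊎-dec asserts? `¬_ i b

      negation : Subset k → Subset k
      negation b = comprehension (negates? b)

      ⟦_⟧ : Formula → Subset k
      ⟦ var m ⟧  = truth (var m)
      ⟦ α `∧ β ⟧ = ⟦ α ⟧ ∩ ⟦ β ⟧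
      ⟦ α `∨ β ⟧ = ⟦ α ⟧ ∪ ⟦ β ⟧
      ⟦ α `→ β ⟧ = ∁ ⟦ α ⟧ ∪ ⟦ β ⟧
      ⟦ `¬ α ⟧   = negation ⟦ α ⟧
      ⟦ `∘ α ⟧   = consistency ⟦ α ⟧

      Represents : Subset k → Formula → Set
      Represents b α = ∀ i → literals (W i) ⊩ signed (lookup b i) α

      truth-represents : sub α ⊆ sub φ → Represents (truth α) α
      truth-represents {α} α⊆ i rewrite lookup∘tabulate (λ i → eval (W i) α) i =
        signed-eval (W i) α α⊆

      asserts⁻ : ∀ {op i b} → Asserts op i b →
        ∃[ ψ ] Represents b ψ × (literals (W i) ⊩ op ψ)
      asserts⁻ {i = i} any with find any
      ... | ψ , ψ∈ , refl , eq = ψ , truth-represents (sub-trans φ ψ∈) , lookup-true (W i) eq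

      -- Soundness of the operations and the truth lemma

      module _ (covering : Covering W) where

        -- The two formulas carry the same sign at each world, hence are equivalent there. Covering
        -- upgrades this to a theorem, as R¬ and R∘ require.
        represents-unique : ∀ b → Represents b α → Represents b β → ¬ ¬ Thm (α `↔ β)
        represents-unique b rα rβ = covering λ i → signed-↔ (lookup b i) (rα i) (rβ i)

        -- By induction along the closure, each member is represented by some ψ with ∘ψ derivable at
        -- i: generators by assertion, combinations by the axiom `ca`. Uniqueness and R∘ then pass
        -- from ψ to α.
        consistency-sound : ∀ {b i} → Represents b α → i ∈ consistency b →
          ¬ ¬ (literals (W i) ⊩ `∘ α)
        consistency-sound {α} {b} {i} rα i∈ ¬⊩ = generated-induction (Asserts `∘_ i)
          (λ c → ∃[ ψ ] Represents c ψ × (literals (W i) ⊩ `∘ ψ))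
          asserts⁻
          (λ {p} {q} (ψ , rψ , ∘ψ) (χ , rχ , ∘χ) → ψ ⟨ # ⟩ χ ,
            (λ j → subst (λ v → literals (W j) ⊩ signed v (ψ ⟨ # ⟩ χ)) (sym (lookup-⟨⟩ # p q j))
                         (signed-⟨⟩ # (lookup p j) (lookup q j) (rψ j) (rχ j))) ,
            thm (axiom (inj₂ (ca ψ χ))) · pair ∘ψ ∘χ)
          (∈-comprehension⁻ (consistent? b) i∈)
          λ (ψ , rψ , ∘ψ) → represents-unique b rψ rα λ eq → ¬⊩ (fst (thm (R∘ eq)) · ∘ψ)

        negation-sound : ∀ {b i} → Represents b α → i ∈ negation b → ¬ ¬ (literals (W i) ⊩ `¬ α)
        negation-sound {α} {b} {i} rα i∈ with ∈-comprehension⁻ (negates? b) i∈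
        ... | inj₂ any  = let ψ , rψ , ¬ψ = asserts⁻ any in
          λ ¬⊩ → represents-unique b rψ rα λ eq → ¬⊩ (fst (thm (R¬ eq)) · ¬ψ)
        ... | inj₁ b≡f  = λ ¬⊩ → ¬⊩ $ cases (ax (ax-em α))
          (deduction (exfalso (weaken ⊩~α · assumption))) (deduction assumption)
          where
          ⊩~α : literals (W i) ⊩ signed false α
          ⊩~α = subst (λ v → literals (W i) ⊩ signed v α) b≡f (rα i)

        -- Bits are decidable although soundness is doubly negated. A world in p where α evaluates
        -- to false derives the classical negation of α, so soundness makes it inconsistent.
        truth-lemma-step : ∀ α (p : Subset k) → sub α ⊆ sub φ →
          (∀ i → i ∈ p → ¬ ¬ (literals (W i) ⊩ α)) → (∀ i → eval (W i) α ≡ true → i ∈ p) →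
          (∃[ i ] Inconsistent (W i)) ⊎ p ≡ truth α
        truth-lemma-step α p α⊆ sound complete
          with any? (λ i → (i ∈? p) ×-dec (eval (W i) α Bool.≟ false))
        ... | yes (i , i∈ , eq) = inj₁ (i , λ ¬⊩ → sound i i∈ λ ⊩α →
          ¬⊩ (subst (λ v → literals (W i) ⊩ signed v α) eq (signed-eval (W i) α α⊆) · ⊩α))
        ... | no ∄ = inj₂ (lookup-ext λ i → trans (agree i) (sym (lookup∘tabulate _ i)))
          where
          agree : ∀ i → lookup p i ≡ eval (W i) α
          agree i with lookup p i in p≡ | eval (W i) α in e≡
          ... | true  | true  = refl
          ... | true  | false = contradiction (i , lookup⇒[]= i p p≡ , e≡) ∄
          ... | false | false = refl
          ... | false | true  = trans (sym p≡) ([]=⇒lookup (complete i e≡))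

        -- The hypothesis is definitional for each concrete connective, but `eval` is stuck while c
        -- is a variable.
        truth-⟨⟩ : ∀ c → (∀ i → eval (W i) (α ⟨ c ⟩ β) ≡ eval (W i) α ⟨ c ⟩ᵇ eval (W i) β) →
          truth α ⟨ c ⟩ˢ truth β ≡ truth (α ⟨ c ⟩ β)
        truth-⟨⟩ {α} {β} c eq = lookup-ext λ i → begin
          lookup (truth α ⟨ c ⟩ˢ truth β) i
            ≡⟨ lookup-⟨⟩ c (truth α) (truth β) i ⟩
          lookup (truth α) i ⟨ c ⟩ᵇ lookup (truth β) i
            ≡⟨ cong₂ (_⟨ c ⟩ᵇ_) (lookup∘tabulate _ i) (lookup∘tabulate _ i) ⟩
          eval (W i) α ⟨ c ⟩ᵇ eval (W i) β
            ≡⟨ eq i ⟨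
          eval (W i) (α ⟨ c ⟩ β)
            ≡⟨ lookup∘tabulate _ i ⟨
          lookup (truth (α ⟨ c ⟩ β)) i
            ∎
          where open ≡-Reasoning

        -- For ¬ and ∘, completeness takes α itself as the asserted subformula; the soundness lemmas
        -- give the converse or expose an inconsistent world.
        truth-lemma : ∀ α → sub α ⊆ sub φ → (∃[ i ] Inconsistent (W i)) ⊎ ⟦ α ⟧ ≡ truth α

        private
          truth-lemma-⟨⟩ : ∀ c α β → sub α ++ sub β ⊆ sub φ →
            (∀ i → eval (W i) (α ⟨ c ⟩ β) ≡ eval (W i) α ⟨ c ⟩ᵇ eval (W i) β) →
            (∃[ i ] Inconsistent (W i)) ⊎ ⟦ α ⟧ ⟨ c ⟩ˢ ⟦ β ⟧ ≡ truth (α ⟨ c ⟩ β)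
          truth-lemma-⟨⟩ c α β α⊆ eq
            with truth-lemma α (α⊆ ∘ ∈-++⁺ˡ) | truth-lemma β (α⊆ ∘ ∈-++⁺ʳ (sub α))
          ... | inj₁ bad | _        = inj₁ bad
          ... | inj₂ _   | inj₁ bad = inj₁ bad
          ... | inj₂ eα  | inj₂ eβ  = inj₂ (trans (cong₂ (_⟨ c ⟩ˢ_) eα eβ) (truth-⟨⟩ c eq))

        truth-lemma (var m)  α⊆ = inj₂ refl
        truth-lemma (α `∧ β) α⊆ = truth-lemma-⟨⟩ and α β (α⊆ ∘ there) (λ _ → refl)
        truth-lemma (α `∨ β) α⊆ = truth-lemma-⟨⟩ or  α β (α⊆ ∘ there) (λ _ → refl)
        truth-lemma (α `→ β) α⊆ = truth-lemma-⟨⟩ imp α β (α⊆ ∘ there) (λ _ → refl)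
        truth-lemma (`¬ α)   α⊆ with truth-lemma α (α⊆ ∘ there)
        ... | inj₁ bad = inj₁ bad
        ... | inj₂ eq rewrite eq = truth-lemma-step (`¬ α) (negation (truth α)) α⊆
          (λ _ → negation-sound (truth-represents (α⊆ ∘ there)))
          (λ _ ev → ∈-comprehension⁺ (negates? (truth α))
            (inj₂ (lose (α⊆ (there (sub-refl α))) (refl , ev))))
        truth-lemma (`∘ α)   α⊆ with truth-lemma α (α⊆ ∘ there)
        ... | inj₁ bad = inj₁ bad
        ... | inj₂ eq rewrite eq = truth-lemma-step (`∘ α) (consistency (truth α)) α⊆
          (λ _ → consistency-sound (truth-represents (α⊆ ∘ there)))
          (λ i ev → ∈-comprehension⁺ (consistent? (truth α))
            (generator (Asserts `∘_ i) (lose (α⊆ (there (sub-refl α))) (refl , ev))))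

        -- Membership in b excludes the complement clause of `negation`, so b is the truth set of
        -- some ψ with ¬ψ true at i. Soundness adds ∘ψ.
        explosive : ∀ {b i} → i ∈ b → i ∈ negation b → i ∈ consistency b → Inconsistent (W i)
        explosive {b} {i} i∈b i∈¬b i∈∘b ¬⊩ with ∈-comprehension⁻ (negates? b) i∈¬b
        ... | inj₁ b≡f = contradiction (trans (sym ([]=⇒lookup i∈b)) b≡f) λ ()
        ... | inj₂ any with asserts⁻ any
        ...   | ψ , rψ , ¬ψ = consistency-sound rψ i∈∘b λ ∘ψ → ¬⊩ $ explosion
          (subst (λ v → literals (W i) ⊩ signed v ψ) ([]=⇒lookup i∈b) (rψ i)) ¬ψ ∘ψ

      -- The BALFI laws

      negation-em : ∀ b → b ∪ negation b ≡ ⊤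
      negation-em b = lookup-ext λ i → begin
        lookup (b ∪ negation b) i               ≡⟨ lookup-⟨⟩ or b (negation b) i ⟩
        lookup b i Bool.∨ lookup (negation b) i ≡⟨ em i ⟩
        true                                    ≡⟨ lookup-replicate i true ⟨
        lookup ⊤ i                              ∎
        where
        open ≡-Reasoning
        em : ∀ i → lookup b i Bool.∨ lookup (negation b) i ≡ true
        em i with lookup b i in eq
        ... | true  = refl
        ... | false = []=⇒lookup (∈-comprehension⁺ (negates? b) (inj₁ eq))

      -- All other laws hold for an arbitrary family of worlds; only the explosion law depends on
      -- their consistency.
      balfi : (∀ b → (b ∩ negation b) ∩ consistency b ≡ ⊥) → BALFI 0ℓ 0ℓ
      balfi explosion-law = record
        { Carrier          = Subset k
        ; _≈_              = _≡_
        ; _∧_              = _∩_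
        ; _∨_              = _∪_
        ; _⇒_              = λ p q → ∁ p ∪ q
        ; ¬_               = negation
        ; ∘_               = consistency
        ; 0#               = ⊥
        ; 1#               = ⊤
        ; isBooleanAlgebra = record
          { isDistributiveLattice = IsBooleanAlgebra.isDistributiveLattice (∪-∩-isBooleanAlgebra k)
          ; ∨-complement          =
            -- The complement of p here is p ⇒ 0#, which unfolds to `∁ p ∪ ⊥`.
            (λ p → trans (cong (_∪ p) (∪-identityʳ (∁ p))) (proj₁ ∪-inverse p)) ,
            (λ p → trans (cong (p ∪_) (∪-identityʳ (∁ p))) (proj₂ ∪-inverse p))
          ; ∧-complement          =
            (λ p → trans (cong (_∩ p) (∪-identityʳ (∁ p))) (proj₁ ∩-inverse p)) ,
            (λ p → trans (cong (p ∩_) (∪-identityʳ (∁ p))) (proj₂ ∩-inverse p))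
          ; ¬-cong                = cong (λ p → ∁ p ∪ ⊥)
          }
        ; ⇒-def            = λ p q → cong (_∪ q) (sym (∪-identityʳ (∁ p)))
        ; ¬-cong           = cong negation
        ; ∘-cong           = cong consistency
        ; ∨-¬              = negation-em
        ; ∧-¬-∘            = explosion-law
        }

      consistency-⟨#⟩ : ∀ p q i →
        i ∈ consistency p → i ∈ consistency q → i ∈ consistency (p ⟨ # ⟩ˢ q)
      consistency-⟨#⟩ p q i i∈p i∈q = ∈-comprehension⁺ (consistent? (p ⟨ # ⟩ˢ q))
        (generated-∙ (Asserts `∘_ i)
          (∈-comprehension⁻ (consistent? p) i∈p) (∈-comprehension⁻ (consistent? q) i∈q))

    -- Removing worlds until a countermodel remains

    Countermodel : Set₁
    Countermodel = Σ[ A ∈ BALFI 0ℓ 0ℓ ] (Finite A × BI[ca # ] A ×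
      (Σ[ v ∈ Valuation A ] ¬ (v satisfies φ)))

    module _ (⊬φ : ¬ Thm φ) where

      countermodel-or-inconsistent : (W : Fin n → World (sub φ)) → Covering W →
        (∃[ i ] Inconsistent (W i)) ⊎ Countermodel
      countermodel-or-inconsistent {n} W covering
        -- A violation of the explosion law can be searched for, there being finitely many sets and
        -- worlds.
        with anySubset? (λ b → any? λ i → i ∈? (b ∩ negation b) ∩ consistency b)
           | truth-lemma covering φ id
        where open Model W
      ... | yes (b , i , i∈) | _ = inj₁ (i ,
        (let i∈∧ , i∈∘ = x∈p∩q⁻ _ _ i∈
             i∈b , i∈¬ = x∈p∩q⁻ _ _ i∈∧
         in Model.explosive W covering i∈b i∈¬ i∈∘))
      ... | no _    | inj₁ bad = inj₁ bad
      ... | no ∄b   | inj₂ eq  = inj₂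
        ( A
        , (2 ^ n , Subset↔Fin n)
        , (λ { v (ca α β) → validates v α β })
        , record
          { ⟦_⟧    = ⟦_⟧
          ; ∧-homo = λ _ _ → refl
          ; ∨-homo = λ _ _ → refl
          ; →-homo = λ _ _ → refl
          ; ¬-homo = λ _ → refl
          ; ∘-homo = λ _ → refl
          }
        -- If φ had value ⊤, the truth lemma would make it true, hence derivable, at every world,
        -- and covering would contradict unprovability.
        , λ ⟦φ⟧≡⊤ → covering (λ i → subst (λ b → literals (W i) ⊩ signed b φ)
            (trans (sym (lookup∘tabulate _ i))
              (trans (cong (λ p → lookup p i) (trans (sym eq) ⟦φ⟧≡⊤)) (lookup-replicate i true)))
            (signed-eval (W i) φ id)) ⊬φ
        )
        where
        open Model W
        A : BALFI 0ℓ 0ℓ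
        A = balfi λ b → Empty-unique λ (i , i∈) → ∄b (b , i , i∈)

        validates : (v : Valuation A) → ∀ α β →
          v satisfies (((`∘ α) `∧ (`∘ β)) `→ (`∘ (α ⟨ # ⟩ β)))
        validates v α β = begin
          V.⟦ ((`∘ α) `∧ (`∘ β)) `→ (`∘ (α ⟨ # ⟩ β)) ⟧
            ≡⟨ V.→-homo _ _ ⟩
          ∁ V.⟦ (`∘ α) `∧ (`∘ β) ⟧ ∪ V.⟦ `∘ (α ⟨ # ⟩ β) ⟧
            ≡⟨ cong₂ (λ p q → ∁ p ∪ q)
                 (trans (V.∧-homo _ _) (cong₂ _∩_ (V.∘-homo α) (V.∘-homo β)))
                 (trans (V.∘-homo _) (cong consistency (homo #))) ⟩
          ∁ (consistency V.⟦ α ⟧ ∩ consistency V.⟦ β ⟧) ∪ consistency (V.⟦ α ⟧ ⟨ # ⟩ˢ V.⟦ β ⟧)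
            ≡⟨ ∁-∪-⊤ (λ i i∈ → uncurry (consistency-⟨#⟩ _ _ i) (x∈p∩q⁻ _ _ i∈)) ⟩
          ⊤ ∎
          where
          open ≡-Reasoning
          module V = Valuation v
          homo : ∀ c → V.⟦ α ⟨ c ⟩ β ⟧ ≡ V.⟦ α ⟧ ⟨ c ⟩ˢ V.⟦ β ⟧
          homo and = V.∧-homo α β
          homo or  = V.∨-homo α β
          homo imp = V.→-homo α β

      countermodel : (W : Fin n → World (sub φ)) → Covering W → Countermodel
      countermodel {n} W covering with countermodel-or-inconsistent W covering
      countermodel {n}     W covering | inj₂ model    = model
      -- Each removal lowers the number of worlds; with none left there is no index to be
      -- inconsistent.
      countermodel {suc n} W covering | inj₁ (i , bad) =
        countermodel (W ∘ punchIn i) (remove-inconsistent W i bad covering)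

theorem5p5 : (# : Connective) (φ : Formula) →
    ¬ (RmbC[ca # ] ⊢ φ) →
    Σ[ A ∈ BALFI 0ℓ 0ℓ ] (Finite A × BI[ca # ] A ×
    (Σ[ v ∈ Valuation A ] ¬ (v satisfies φ)))
theorem5p5 # φ ⊬φ = countermodel φ ⊬φ _ (initial-covering φ)
  where open Calculus #
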